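{- Let $G=(V,E)$ be a hypergraph, $k\ge 2$ an integer, and $\emptyset\neq R\subsetneq U\subsetneq V$. Let $S=\{u_1,\dots,u_p\}\subseteq U\setminus R$ with $p\ge 2k-2$. For each $i\in[p]$ let $(\overline{A_i},A_i)$ be a minimum $((S\cup R)\setminus\{u_i\},\overline{U})$-terminal cut. Suppose that $u_i\in A_i\setminus\bigl(\bigcup_{j\in[p]\setminus\{i\}}A_j\bigr)$ for every $i\in[p]$. Then there exists a $k$-partition $(P_1,\dots,P_k)$ of $V$ with $\overline{U}\subsetneq P_k$ such that \[\mathrm{cost}(P_1,\dots,P_k)\le \tfrac12\min\{d(A_i)+d(A_j): i,j\in[p],\ i\neq j\}.\]
   Context: A hypergraph $G=(V,E)$ has finite vertex set $V$ and finite multiset $E$ of hyperedges (subsets of $V$). For $X\subseteq V$, $\overline X=V\setminus X$ and $d(X)$ is the number of hyperedges meeting both $X$ and $\overline X$. For a partition of $V$ into non-empty parts, $\mathrm{cost}$ is the number of hyperedges meeting at least two parts. For disjoint $S',T'\subseteq V$, a 2-partition $(X,\overline X)$ is an $(S',T')$-terminal cut if $S'\subseteq X\subseteq V\setminus T'$ (so here $(S\cup R)\setminus\{u_i\}\subseteq\overline{A_i}$ and $\overline U\subseteq A_i$); it is minimum if $d(X)$ is minimum among all $(S',T')$-terminal cuts. -}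

module Defs where

open import Data.Fin using (Fin; fromℕ)
open import Data.Fin.Properties using (_≟_; any?)
open import Data.Fin.Subset using (Subset; _∈_; _⊆_; ∁; _∩_; ⋃; ⁅_⁆; Nonempty; Empty)
open import Data.Fin.Subset.Properties using (nonempty?)
open import Data.List using (List; length; filter; map; allFin)
open import Data.Nat using (ℕ; _+_; _≤_; s≤s)
open import Data.Product using (∃; _×_)
open import Function using (_∘_)
open import Relation.Binary.PropositionalEquality using (_≡_; _≢_)
open import Relation.Nullary using (Dec)
open import Relation.Nullary.Decidable using (_×-dec_; ¬?)

-- The vertex set is Fin n; the list of edges represents a finite multiset.
record Hypergraph (n : ℕ) : Set where
  field
    edges : List (Subset n)

open Hypergraph public

Meets : ∀ {n} → Subset n → Subset n → Set
Meets e X = Nonempty (e ∩ X)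

meets? : ∀ {n} (e X : Subset n) → Dec (Meets e X)
meets? e X = nonempty? (e ∩ X)

Crosses : ∀ {n} → Subset n → Subset n → Set
Crosses X e = Meets e X × Meets e (∁ X)

crosses? : ∀ {n} (X e : Subset n) → Dec (Crosses X e)
crosses? X e = meets? e X ×-dec meets? e (∁ X)

d : ∀ {n} → Hypergraph n → Subset n → ℕ
d G X = length (filter (crosses? X) (edges G))

record IsPartition {n k : ℕ} (P : Fin k → Subset n) : Set where
  field
    nonempty : ∀ i → Nonempty (P i)
    disjoint : ∀ i j → i ≢ j → Empty (P i ∩ P j)
    cover    : ∀ x → ∃ λ i → x ∈ P i

MeetsTwoParts : ∀ {n k} → (Fin k → Subset n) → Subset n → Set
MeetsTwoParts P e = ∃ λ i → ∃ λ j → i ≢ j × Meets e (P i) × Meets e (P j)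

meetsTwoParts? : ∀ {n k} (P : Fin k → Subset n) (e : Subset n) → Dec (MeetsTwoParts P e)
meetsTwoParts? P e =
  any? λ i → any? λ j → ¬? (i ≟ j) ×-dec (meets? e (P i) ×-dec meets? e (P j))

cost : ∀ {n k} → Hypergraph n → (Fin k → Subset n) → ℕ
cost G P = length (filter (meetsTwoParts? P) (edges G))

-- The 2-partition (X , ∁ X) is represented by its first side X.
record IsTerminalCut {n : ℕ} (S T X : Subset n) : Set where
  field
    nonemptyˡ : Nonempty X
    nonemptyʳ : Nonempty (∁ X)
    source    : S ⊆ X
    sink      : X ⊆ ∁ T

record IsMinTerminalCut {n : ℕ} (G : Hypergraph n) (S T X : Subset n) : Set where
  field
    isTerminalCut : IsTerminalCut S T X
    minimum       : ∀ Y → IsTerminalCut S T Y → d G X ≤ d G Y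

image : ∀ {n p} → (Fin p → Fin n) → Subset n
image {p = p} u = ⋃ (map (⁅_⁆ ∘ u) (allFin p))

⋃Except : ∀ {n p} → Fin p → (Fin p → Subset n) → Subset n
⋃Except {p = p} i A = ⋃ (map A (filter (λ j → ¬? (j ≟ i)) (allFin p)))

IsMinimum : (ℕ → Set) → ℕ → Set
IsMinimum Q m = Q m × (∀ m′ → Q m′ → m ≤ m′)

PairSum : ∀ {p} → (Fin p → ℕ) → ℕ → Set
PairSum f m = ∃ λ i → ∃ λ j → i ≢ j × m ≡ f i + f j

lastIndex : ∀ {k} → 2 ≤ k → Fin k
lastIndex (s≤s {n = m} _) = fromℕ m

{-# OPTIONS --safe #-}

-- Let depth v be the number of sets A q containing v, let level l be the set
-- of vertices of depth at least l, and let Yᵢ be the set of vertices lying in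
-- A i and in no other A q.  For 3 ≤ l ≤ p the set level l contains ∁ U and no
-- terminal, so minimality gives d (A q) ≤ d (level l) for every q.
--
-- Take two disjoint families of k - 1 of the Yᵢ, and complete each of them to
-- a k-partition by putting all other vertices into the last part.  Comparing
-- the contributions of each hyperedge shows
--   cost P + cost P′ + Σ_{l=3}^p d (level l) ≤ Σ_q d (A q).
-- For the pair i, j attaining the minimum, the p - 2 other terms on the right
-- are absorbed by the levels, hence cost P + cost P′ ≤ d (A i) + d (A j), and
-- the cheaper of the two partitions will do.
module Submission where

open import Defs
open import Data.Bool using (if_then_else_)
open import Data.Empty using (⊥-elim)
open import Data.Fin using (Fin; zero; suc; toℕ; fromℕ; inject₁; inject≤; punchIn; punchOut; _↑ˡ_; _↑ʳ_; splitAt)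
open import Data.Fin.Properties using (_≟_; any?; all?; toℕ<n; punchInᵢ≢i; punchIn-punchOut; inject≤-injective; ↑ˡ-injective; ↑ʳ-injective; splitAt-↑ˡ; splitAt-↑ʳ)
open import Data.Fin.Relation.Unary.Top using (view; ‵fromℕ; ‵inject₁)
open import Data.Fin.Subset using (Subset; _∈_; _∉_; _⊆_; _⊂_; ⊤; ∁; _∪_; _─_; _-_; ⋃; ⁅_⁆; Nonempty)
open import Data.Fin.Subset.Properties using (_∈?_; nonempty?; x∈∁p⇒x∉p; x∉p⇒x∈∁p; x∈p∩q⁺; x∈p∩q⁻; x∈p∪q⁺; x∈p∪q⁻; ∉⊥; x∈⁅x⁆; x∈⁅y⁆⇒x≡y; x∈p∧x≢y⇒x∈p-y; p─q⊆p)
open import Data.List using (List; []; _∷_; length; filter; map; allFin; cartesianProduct)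
open import Data.List.Membership.Propositional using () renaming (_∈_ to _∈ₗ_)
open import Data.List.Membership.Propositional.Properties using (∈-allFin; ∈-cartesianProduct⁺; ∈-filter⁺)
open import Data.List.Properties using (filter-≐)
open import Data.List.Relation.Unary.All using (lookup)
open import Data.List.Relation.Unary.All.Properties using (all-filter)
open import Data.List.Relation.Unary.Any using (here; there)
open import Data.Nat using (ℕ; zero; suc; _+_; _*_; _∸_; _≤_; _<_; z≤n; s≤s; _≤?_)
open import Data.Nat.Properties hiding (_≟_)
open import Data.Nat.Solver using (module +-*-Solver)
open import Data.Product using (Σ; ∃; _×_; _,_; proj₁; proj₂)
open import Data.Sum using (_⊎_; inj₁; inj₂)
open import Data.Vec using (_∷_; here; there) renaming (tabulate to tabulateᵛ)
open import Data.Vec.Functional using (removeAt)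
open import Data.Vec.Properties using (lookup∘tabulate; lookup⇒[]=; []=⇒lookup)
open import Function using (_∘_)
open import Function.Definitions using (Injective)
open import Relation.Binary.PropositionalEquality using (_≡_; _≢_; refl; sym; trans; cong; cong₂; subst)
open import Relation.Nullary using (Dec; yes; no; does; ¬_)
open import Relation.Nullary.Decidable using (_×-dec_; _→-dec_; ¬?; dec-true)
open import Relation.Unary using (Decidable)

open import Algebra.Properties.CommutativeMonoid.Sum +-0-commutativeMonoid using (sum; sum-cong-≗; sum-remove; ∑-distrib-+)
open import Data.List.Extrema ≤-totalOrder using (argmin; argmax; argmin-all; argmax-all; f[argmin]≤f[xs]; f[xs]≤f[argmax])

-- Indicators, finite sums and extrema

⟦_⟧ : ∀ {P : Set} → Dec P → ℕ
⟦ P? ⟧ = if does P? then 1 else 0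

⟦⟧≤ : ∀ {P : Set} (P? : Dec P) {m} → (P → 1 ≤ m) → ⟦ P? ⟧ ≤ m
⟦⟧≤ (yes p) h = h p
⟦⟧≤ (no _)  h = z≤n

1≤⟦⟧ : ∀ {P : Set} (P? : Dec P) → P → 1 ≤ ⟦ P? ⟧
1≤⟦⟧ (yes _) p = ≤-refl
1≤⟦⟧ (no ¬p) p = ⊥-elim (¬p p)

length-filter-∷ : ∀ {X : Set} {P : X → Set} (P? : Decidable P) x xs →
  length (filter P? (x ∷ xs)) ≡ ⟦ P? x ⟧ + length (filter P? xs)
length-filter-∷ P? x xs with P? x
... | yes _ = refl
... | no _  = refl

sum-mono-≤ : ∀ {n} (f g : Fin n → ℕ) → (∀ i → f i ≤ g i) → sum f ≤ sum g
sum-mono-≤ {zero}  f g h = z≤n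
sum-mono-≤ {suc n} f g h = +-mono-≤ (h zero) (sum-mono-≤ (f ∘ suc) (g ∘ suc) (h ∘ suc))

sum-const : ∀ n c → sum {n} (λ _ → c) ≡ n * c
sum-const zero    c = refl
sum-const (suc n) c = cong (c +_) (sum-const n c)

sum-remove₂ : ∀ {n} (f : Fin (2 + n) → ℕ) {i j} (i≢j : i ≢ j) →
  sum f ≡ f i + f j + sum (removeAt (removeAt f i) (punchOut i≢j))
sum-remove₂ f {i} {j} i≢j = begin-equality
  sum f                                    ≡⟨ sum-remove {i = i} f ⟩
  f i + sum (removeAt f i)                 ≡⟨ cong (f i +_) (sum-remove {i = punchOut i≢j} (removeAt f i)) ⟩
  f i + (f (punchIn i (punchOut i≢j)) + r) ≡⟨ cong (λ x → f i + (f x + r)) (punchIn-punchOut i≢j) ⟩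
  f i + (f j + r)                          ≡⟨ +-assoc (f i) (f j) r ⟨
  f i + f j + r                            ∎
  where
  open ≤-Reasoning
  r = sum (removeAt (removeAt f i) (punchOut i≢j))

pair≤sum : ∀ {n} (f : Fin (2 + n) → ℕ) {i j} → i ≢ j → f i + f j ≤ sum f
pair≤sum f i≢j = ≤-trans (m≤m+n _ _) (≤-reflexive (sym (sum-remove₂ f i≢j)))

sum≤pair+ : ∀ {n} (f : Fin (2 + n) → ℕ) {i j} D → i ≢ j → (∀ q → f q ≤ D) →
  sum f ≤ f i + f j + n * D
sum≤pair+ {n} f {i} {j} D i≢j f≤D = begin
  sum f                                                    ≡⟨ sum-remove₂ f i≢j ⟩
  f i + f j + sum (removeAt (removeAt f i) (punchOut i≢j)) ≤⟨ +-monoʳ-≤ (f i + f j) (sum-mono-≤ (removeAt (removeAt f i) (punchOut i≢j)) (λ _ → D) (λ _ → f≤D _)) ⟩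
  f i + f j + sum {n} (λ _ → D)                            ≡⟨ cong (f i + f j +_) (sum-const n D) ⟩
  f i + f j + n * D                                        ∎
  where open ≤-Reasoning

-- The numbers `a + toℕ t` are distinct, and those counted lie in the interval (m, M]. The offset
-- `a` is what varies in the induction on `s`.
sum-window : ∀ {s} {Q : Fin s → Set} (Q? : Decidable Q) a {m M} →
  (∀ t → Q t → m < a + toℕ t × a + toℕ t ≤ M) → sum (λ t → ⟦ Q? t ⟧) ≤ M ∸ m
sum-window {zero}  Q? a h = z≤n
sum-window {suc s} Q? a {m} {M} h with Q? zero
... | no _  = sum-window (Q? ∘ suc) (suc a) λ t q →
  let (l , r) = h (suc t) q in subst (m <_) (+-suc a _) l , subst (_≤ M) (+-suc a _) r
-- Once `a` itself is counted, the rest lies in (a, M], and 1 + (M ∸ a) ≤ M ∸ m because m < a ≤ M.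
... | yes q₀ = ≤-trans
  (s≤s (sum-window (Q? ∘ suc) (suc a) λ t q →
    s≤s (m≤m+n a _) , subst (_≤ M) (+-suc a _) (proj₂ (h (suc t) q))))
  (≤-trans (≤-reflexive (sym (+-∸-assoc 1 a≤M))) (∸-monoʳ-≤ (suc M) m<a))
  where
  m<a = subst (m <_) (+-identityʳ a) (proj₁ (h zero q₀))
  a≤M = subst (_≤ M) (+-identityʳ a) (proj₂ (h zero q₀))

module _ {X : Set} where

  private
    # : {P : X → Set} → Decidable P → List X → ℕ
    # P? xs = length (filter P? xs)

  sum-length-filter-∷ : ∀ {m} {P : Fin m → X → Set} (P? : ∀ q → Decidable (P q)) x xs →
    sum (λ q → # (P? q) (x ∷ xs)) ≡ sum (λ q → ⟦ P? q x ⟧) + sum (λ q → # (P? q) xs)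
  sum-length-filter-∷ P? x xs = trans (sum-cong-≗ λ q → length-filter-∷ (P? q) x xs)
    (∑-distrib-+ (λ q → ⟦ P? q x ⟧) (λ q → # (P? q) xs))

  -- Exchanging the order of summation leaves only the contribution of a single hyperedge to be
  -- estimated.
  length-filter-sum-mono : ∀ {a b} {P P′ : X → Set} {Q : Fin a → X → Set} {T : Fin b → X → Set}
    (P? : Decidable P) (P′? : Decidable P′) (Q? : ∀ t → Decidable (Q t)) (T? : ∀ q → Decidable (T q)) →
    (∀ x → ⟦ P? x ⟧ + ⟦ P′? x ⟧ + sum (λ t → ⟦ Q? t x ⟧) ≤ sum (λ q → ⟦ T? q x ⟧)) →
    ∀ xs → # P? xs + # P′? xs + sum (λ t → # (Q? t) xs) ≤ sum (λ q → # (T? q) xs)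
  length-filter-sum-mono {a} P? P′? Q? T? h [] =
    ≤-trans (≤-reflexive (trans (sum-const a 0) (*-zeroʳ a))) z≤n
  length-filter-sum-mono P? P′? Q? T? h (x ∷ xs) = begin
    # P? (x ∷ xs) + # P′? (x ∷ xs) + sum (λ t → # (Q? t) (x ∷ xs))
      ≡⟨ cong₂ _+_ (cong₂ _+_ (length-filter-∷ P? x xs) (length-filter-∷ P′? x xs))
           (sum-length-filter-∷ Q? x xs) ⟩
    (p + ps) + (p′ + ps′) + (q + qs)
      ≡⟨ solve 6 (λ p ps p′ ps′ q qs →
           (p :+ ps) :+ (p′ :+ ps′) :+ (q :+ qs) := (p :+ p′ :+ q) :+ (ps :+ ps′ :+ qs))
           refl p ps p′ ps′ q qs ⟩
    (p + p′ + q) + (ps + ps′ + qs)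
      ≤⟨ +-mono-≤ (h x) (length-filter-sum-mono P? P′? Q? T? h xs) ⟩
    sum (λ q → ⟦ T? q x ⟧) + sum (λ q → # (T? q) xs)
      ≡⟨ sum-length-filter-∷ T? x xs ⟨
    sum (λ q → # (T? q) (x ∷ xs)) ∎
    where
    open ≤-Reasoning
    open +-*-Solver using (solve; _:+_; _:=_)
    p   = ⟦ P? x ⟧
    ps  = # P? xs
    p′  = ⟦ P′? x ⟧
    ps′ = # P′? xs
    q   = sum (λ t → ⟦ Q? t x ⟧)
    qs  = sum (λ t → # (Q? t) xs)

module _ {X : Set} {P : X → Set} (P? : Decidable P) (f : X → ℕ) (xs : List X) where

  -- The given witness is the default value of `argmin`; as it satisfies `P`, the result does too,
  -- whatever the list contains.
  minimiser : ∃ P → ∃ λ x → P x × (∀ {y} → y ∈ₗ xs → P y → f x ≤ f y)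
  minimiser (a , Pa) = argmin f a (filter P? xs)
    , argmin-all f Pa (all-filter P? xs)
    , λ y∈ Py → lookup (f[argmin]≤f[xs] a (filter P? xs)) (∈-filter⁺ P? y∈ Py)

  maximiser : ∃ P → ∃ λ x → P x × (∀ {y} → y ∈ₗ xs → P y → f y ≤ f x)
  maximiser (a , Pa) = argmax f a (filter P? xs)
    , argmax-all f Pa (all-filter P? xs)
    , λ y∈ Py → lookup (f[xs]≤f[argmax] a (filter P? xs)) (∈-filter⁺ P? y∈ Py)

-- Subsets

subset : ∀ {n} {P : Fin n → Set} → Decidable P → Subset n
subset P? = tabulateᵛ (does ∘ P?)

∈-subset⁺ : ∀ {n} {P : Fin n → Set} (P? : Decidable P) {x} → P x → x ∈ subset P?
∈-subset⁺ P? {x} Px = lookup⇒[]= x _ (trans (lookup∘tabulate (does ∘ P?) x) (dec-true (P? x) Px))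

∈-subset⁻ : ∀ {n} {P : Fin n → Set} (P? : Decidable P) {x} → x ∈ subset P? → P x
∈-subset⁻ P? {x} x∈ with P? x | trans (sym (lookup∘tabulate (does ∘ P?) x)) ([]=⇒lookup x∈)
... | yes Px | _ = Px
... | no _   | ()

x∈p─q⇒x∉q : ∀ {n} {x} (p q : Subset n) → x ∈ p ─ q → x ∉ q
x∈p─q⇒x∉q (_ ∷ p) (_ ∷ q) () here
x∈p─q⇒x∉q (_ ∷ p) (_ ∷ q) (there x∈) (there x∈q) = x∈p─q⇒x∉q p q x∈ x∈q

∈-⋃-map⁺ : ∀ {n} {X : Set} (F : X → Subset n) {v x xs} → x ∈ₗ xs → v ∈ F x → v ∈ ⋃ (map F xs)
∈-⋃-map⁺ F (here refl) v∈ = x∈p∪q⁺ (inj₁ v∈)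
∈-⋃-map⁺ F (there x∈)  v∈ = x∈p∪q⁺ (inj₂ (∈-⋃-map⁺ F x∈ v∈))

∈-⋃-map⁻ : ∀ {n} {X : Set} (F : X → Subset n) {v} xs → v ∈ ⋃ (map F xs) → ∃ λ x → v ∈ F x
∈-⋃-map⁻ F []       v∈ = ⊥-elim (∉⊥ v∈)
∈-⋃-map⁻ F (x ∷ xs) v∈ with x∈p∪q⁻ (F x) _ v∈
... | inj₁ v∈F = x , v∈F
... | inj₂ v∈⋃ = ∈-⋃-map⁻ F xs v∈⋃

∈-image⁺ : ∀ {n p} (u : Fin p → Fin n) i → u i ∈ image u
∈-image⁺ u i = ∈-⋃-map⁺ (⁅_⁆ ∘ u) (∈-allFin i) (x∈⁅x⁆ (u i))

∈-image⁻ : ∀ {n p} (u : Fin p → Fin n) {v} → v ∈ image u → ∃ λ i → v ≡ u i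
∈-image⁻ u v∈ with ∈-⋃-map⁻ (⁅_⁆ ∘ u) (allFin _) v∈
... | i , v∈⁅ui⁆ = i , x∈⁅y⁆⇒x≡y (u i) v∈⁅ui⁆

crosses⁺ : ∀ {n} {X e : Subset n} {x y} → x ∈ e → x ∈ X → y ∈ e → y ∉ X → Crosses X e
crosses⁺ x∈e x∈X y∈e y∉X = (_ , x∈p∩q⁺ (x∈e , x∈X)) , (_ , x∈p∩q⁺ (y∈e , x∉p⇒x∈∁p y∉X))

crosses⁻ : ∀ {n} (X e : Subset n) → Crosses X e →
  ∃ λ x → ∃ λ y → x ∈ e × x ∈ X × y ∈ e × y ∉ X
crosses⁻ X e ((x , x∈) , (y , y∈)) =
  let (x∈e , x∈X) = x∈p∩q⁻ e X x∈
      (y∈e , y∈∁X) = x∈p∩q⁻ e (∁ X) y∈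
  in x , y , x∈e , x∈X , y∈e , x∈∁p⇒x∉p y∈∁X

∉∁⇒∈ : ∀ {n} {X : Subset n} {x} → x ∉ ∁ X → x ∈ X
∉∁⇒∈ {X = X} {x} x∉∁X with x ∈? X
... | yes x∈X = x∈X
... | no x∉X  = ⊥-elim (x∉∁X (x∉p⇒x∈∁p x∉X))

crosses-∁⁺ : ∀ {n} {X e : Subset n} → Crosses X e → Crosses (∁ X) e
crosses-∁⁺ {X = X} {e} c with crosses⁻ X e c
... | x , y , x∈e , x∈X , y∈e , y∉X = crosses⁺ y∈e (x∉p⇒x∈∁p y∉X) x∈e (λ x∈∁X → x∈∁p⇒x∉p x∈∁X x∈X)

crosses-∁⁻ : ∀ {n} {X e : Subset n} → Crosses (∁ X) e → Crosses X e
crosses-∁⁻ {X = X} {e} c with crosses⁻ (∁ X) e c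
... | x , y , x∈e , x∈∁X , y∈e , y∉∁X = crosses⁺ y∈e (∉∁⇒∈ y∉∁X) x∈e (x∈∁p⇒x∉p x∈∁X)

-- Terminal cuts are given by their source sides `∁ (A i)`, whereas the counting uses the sides
-- `A i`.
d-∁ : ∀ {n} (G : Hypergraph n) X → d G (∁ X) ≡ d G X
d-∁ G X = cong length
  (filter-≐ (crosses? (∁ X)) (crosses? X) (crosses-∁⁻ , crosses-∁⁺) (edges G))

-- Depth, levels and private vertices

module _ {n s : ℕ} (A : Fin (2 + s) → Subset n) where

  depth : Fin n → ℕ
  depth v = sum λ q → ⟦ v ∈? A q ⟧

  level : ℕ → Subset n
  level l = subset λ v → l ≤? depth v

  Private : Fin (2 + s) → Fin n → Set
  Private i v = v ∈ A i × (∀ j → v ∈ A j → j ≡ i)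

  private? : ∀ i v → Dec (Private i v)
  private? i v = (v ∈? A i) ×-dec all? λ j → (v ∈? A j) →-dec (j ≟ i)

  crossed : Subset n → ℕ
  crossed e = sum λ q → ⟦ crosses? (A q) e ⟧

  -- Since p = 2 + s, the levels `3 + toℕ t` run from 3 to p. Leaving out levels 1 and 2 makes room
  -- for the two costs.
  crossedLevels : Subset n → ℕ
  crossedLevels e = sum {s} λ t → ⟦ crosses? (level (3 + toℕ t)) e ⟧

  private-unique : ∀ {i j v} → Private i v → Private j v → i ≡ j
  private-unique (v∈Ai , _) (_ , only-j) = only-j _ v∈Ai

  private⇒depth≤1 : ∀ {i v} → Private i v → depth v ≤ 1
  private⇒depth≤1 {i} {v} (_ , only-i) = begin
    depth v                                   ≡⟨ sum-remove {i = i} (λ q → ⟦ v ∈? A q ⟧) ⟩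
    ⟦ v ∈? A i ⟧ + sum (removeAt (λ q → ⟦ v ∈? A q ⟧) i) ≤⟨ +-mono-≤ (⟦⟧≤ (v ∈? A i) (λ _ → ≤-refl))
                                                   (sum-mono-≤ (removeAt (λ q → ⟦ v ∈? A q ⟧) i) (λ _ → 0) λ q → ⟦⟧≤ (v ∈? A (punchIn i q))
                                                     (λ v∈ → ⊥-elim (punchInᵢ≢i i q (only-i _ v∈)))) ⟩
    1 + sum {suc s} (λ _ → 0)                 ≡⟨ cong suc (trans (sum-const s 0) (*-zeroʳ s)) ⟩
    1                                         ∎
    where open ≤-Reasoning

  ∉all⇒depth≤0 : ∀ {v} → (∀ q → v ∉ A q) → depth v ≤ 0
  ∉all⇒depth≤0 {v} v∉ = begin
    depth v                 ≤⟨ sum-mono-≤ (λ q → ⟦ v ∈? A q ⟧) (λ _ → 0) (λ q → ⟦⟧≤ (v ∈? A q) (λ v∈ → ⊥-elim (v∉ q v∈))) ⟩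
    sum {2 + s} (λ _ → 0)   ≡⟨ trans (sum-const (2 + s) 0) (*-zeroʳ s) ⟩
    0                       ∎
    where open ≤-Reasoning

  ∈all⇒depth : ∀ {v} → (∀ q → v ∈ A q) → 2 + s ≤ depth v
  ∈all⇒depth {v} v∈ = begin
    2 + s                   ≡⟨ trans (sum-const (2 + s) 1) (*-identityʳ (2 + s)) ⟨
    sum {2 + s} (λ _ → 1)   ≤⟨ sum-mono-≤ (λ _ → 1) (λ q → ⟦ v ∈? A q ⟧) (λ q → 1≤⟦⟧ (v ∈? A q) (v∈ q)) ⟩
    depth v                 ∎
    where open ≤-Reasoning

  -- The middle case is depth one, recorded through the index of the set; the outer cases need only
  -- a bound on the depth.
  data DepthView (v : Fin n) : Set where
    none : depth v ≤ 0 → DepthView v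
    one  : ∀ i → Private i v → DepthView v
    many : 2 ≤ depth v → DepthView v

  depthView : ∀ v → DepthView v
  depthView v with any? (λ i → v ∈? A i)
  ... | no ∄i = none (∉all⇒depth≤0 λ q v∈ → ∄i (q , v∈))
  ... | yes (i , v∈Ai) with any? (λ j → (v ∈? A j) ×-dec ¬? (j ≟ i))
  ...   | yes (j , v∈Aj , j≢i) = many (≤-trans
            (+-mono-≤ (1≤⟦⟧ (v ∈? A j) v∈Aj) (1≤⟦⟧ (v ∈? A i) v∈Ai))
            (pair≤sum (λ q → ⟦ v ∈? A q ⟧) j≢i))
  ...   | no ∄j = one i (v∈Ai , only-i)
    where
    only-i : ∀ j → v ∈ A j → j ≡ i
    only-i j v∈Aj with j ≟ i
    ... | yes j≡i = j≡i
    ... | no j≢i  = ⊥-elim (∄j (j , v∈Aj , j≢i))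

  -- A crossed level separates a vertex of `e` of depth at least `l` from one of smaller depth.
  crosses-level : ∀ {e l m M} → (∀ {v} → v ∈ e → m ≤ depth v × depth v ≤ M) →
    Crosses (level l) e → m < l × l ≤ M
  crosses-level {e} {l} {m} h c with crosses⁻ (level l) e c
  ... | x , y , x∈e , x∈L , y∈e , y∉L =
      ≤-trans (s≤s (proj₁ (h y∈e))) (≰⇒> (y∉L ∘ ∈-subset⁺ (λ v → l ≤? depth v)))
    , ≤-trans (∈-subset⁻ (λ v → l ≤? depth v) x∈L) (proj₂ (h x∈e))

  -- Crossed sets and crossed levels of a single hyperedge

  module _ (e : Subset n) where

    deepest : Nonempty e → ∃ λ x → x ∈ e × (∀ {v} → v ∈ e → depth v ≤ depth x)
    deepest ne with maximiser (_∈? e) depth (allFin n) ne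
    ... | x , x∈e , max = x , x∈e , max (∈-allFin _)

    shallowest : Nonempty e → ∃ λ x → x ∈ e × (∀ {v} → v ∈ e → depth x ≤ depth v)
    shallowest ne with minimiser (_∈? e) depth (allFin n) ne
    ... | x , x∈e , min = x , x∈e , min (∈-allFin _)

    -- Each `A q` that contains `x` but not `y` is crossed by `e`.
    depth≤depth+crossed : ∀ {x y} → x ∈ e → y ∈ e → depth x ≤ depth y + crossed e
    depth≤depth+crossed {x} {y} x∈e y∈e = begin
      depth x                                            ≤⟨ sum-mono-≤ (λ q → ⟦ x ∈? A q ⟧) (λ q → ⟦ y ∈? A q ⟧ + ⟦ crosses? (A q) e ⟧) pointwise ⟩
      sum (λ q → ⟦ y ∈? A q ⟧ + ⟦ crosses? (A q) e ⟧)    ≡⟨ ∑-distrib-+ (λ q → ⟦ y ∈? A q ⟧) (λ q → ⟦ crosses? (A q) e ⟧) ⟩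
      depth y + crossed e                                ∎
      where
      open ≤-Reasoning
      pointwise : ∀ q → ⟦ x ∈? A q ⟧ ≤ ⟦ y ∈? A q ⟧ + ⟦ crosses? (A q) e ⟧
      pointwise q = ⟦⟧≤ (x ∈? A q) covered
        where
        covered : x ∈ A q → 1 ≤ ⟦ y ∈? A q ⟧ + ⟦ crosses? (A q) e ⟧
        covered x∈ with y ∈? A q
        ... | yes _ = s≤s z≤n
        ... | no y∉ = 1≤⟦⟧ (crosses? (A q) e) (crosses⁺ x∈e x∈ y∈e y∉)

    -- The levels counted start at 3, and a crossed one cannot exceed the largest depth in `e`.
    crossedLevels≤depth∸2 : ∀ {x} → (∀ {v} → v ∈ e → depth v ≤ depth x) →
      crossedLevels e ≤ depth x ∸ 2
    crossedLevels≤depth∸2 max = sum-window {s} (λ t → crosses? (level (3 + toℕ t)) e) 3 λ t c →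
      s≤s (s≤s (s≤s z≤n)) , proj₂ (crosses-level (λ v∈e → z≤n , max v∈e) c)

    -- Crossed levels lie above the least and not above the largest depth in `e`, and these two
    -- depths differ by at most the number of crossed sets.
    crossedLevels≤crossed : crossedLevels e ≤ crossed e
    crossedLevels≤crossed with nonempty? e
    -- An empty hyperedge crosses nothing, so the empty window serves.
    ... | no ∄x = ≤-trans
      (sum-window {s} (λ t → crosses? (level (3 + toℕ t)) e) 3 {0} {0} λ t c →
        let (x , _ , x∈e , _) = crosses⁻ (level (3 + toℕ t)) e c in ⊥-elim (∄x (x , x∈e)))
      z≤n
    ... | yes ne with deepest ne | shallowest ne
    ... | x , x∈e , max | y , y∈e , min = begin
      crossedLevels e                   ≤⟨ sum-window {s} (λ t → crosses? (level (3 + toℕ t)) e) 3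
                                             (λ t → crosses-level λ v∈e → min v∈e , max v∈e) ⟩
      depth x ∸ depth y                 ≤⟨ ∸-monoˡ-≤ (depth y) (depth≤depth+crossed x∈e y∈e) ⟩
      (depth y + crossed e) ∸ depth y   ≡⟨ m+n∸m≡n (depth y) (crossed e) ⟩
      crossed e                         ∎
      where open ≤-Reasoning

    -- Let `z` be a deepest vertex of `e`. Every set containing `z` omits `x` or `y` and is
    -- therefore crossed, so `crossed e` is at least `depth z`, while at most `depth z ∸ 2` of the
    -- levels are crossed.
    private-pair⇒2+crossedLevels≤crossed : ∀ {i j x y} → i ≢ j →
      x ∈ e → Private i x → y ∈ e → Private j y → 2 + crossedLevels e ≤ crossed e
    private-pair⇒2+crossedLevels≤crossed {i} {j} {x} {y} i≢j x∈e (x∈Ai , only-i) y∈e (y∈Aj , only-j)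
      with deepest (x , x∈e)
    ... | z , z∈e , max = ≤-trans (+-monoʳ-≤ 2 (crossedLevels≤depth∸2 {z} max)) 2+[depth∸2]≤crossed
      where
      2≤crossed : 2 ≤ crossed e
      2≤crossed = ≤-trans
        (+-mono-≤
          (1≤⟦⟧ (crosses? (A i) e) (crosses⁺ x∈e x∈Ai y∈e (i≢j ∘ only-j i)))
          (1≤⟦⟧ (crosses? (A j) e) (crosses⁺ y∈e y∈Aj x∈e (i≢j ∘ sym ∘ only-i j))))
        (pair≤sum (λ q → ⟦ crosses? (A q) e ⟧) i≢j)

      -- No A q contains both x and y.
      pointwise : ∀ q → z ∈ A q → Crosses (A q) e
      pointwise q z∈ with x ∈? A q | y ∈? A q
      ... | no x∉  | _      = crosses⁺ z∈e z∈ x∈e x∉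
      ... | yes _  | no y∉  = crosses⁺ z∈e z∈ y∈e y∉
      ... | yes x∈ | yes y∈ = ⊥-elim (i≢j (trans (sym (only-i q x∈)) (only-j q y∈)))

      depth≤crossed : depth z ≤ crossed e
      depth≤crossed = sum-mono-≤ (λ q → ⟦ z ∈? A q ⟧) (λ q → ⟦ crosses? (A q) e ⟧) λ q →
        ⟦⟧≤ (z ∈? A q) λ z∈ → 1≤⟦⟧ (crosses? (A q) e) (pointwise q z∈)

      2+[depth∸2]≤crossed : 2 + (depth z ∸ 2) ≤ crossed e
      -- For `depth z` below 2 the truncated subtraction gives 0, and the crossed sets `A i` and
      -- `A j` supply the 2.
      2+[depth∸2]≤crossed with 2 ≤? depth z
      ... | yes 2≤ = ≤-trans (≤-reflexive (m+[n∸m]≡n 2≤)) depth≤crossed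
      ... | no 2≰  = ≤-trans (≤-reflexive (cong (2 +_) (m≤n⇒m∸n≡0 (<⇒≤ (≰⇒> 2≰))))) 2≤crossed

    -- The depth of `y` decides what a deepest vertex `z` is compared with: `y` at depth 0, `x` at
    -- depth 2 or more. At depth one, `y` is private to another index and the bound for pairs
    -- applies.
    private-split⇒1+crossedLevels≤crossed : ∀ {i x y} →
      x ∈ e → Private i x → y ∈ e → ¬ Private i y → 1 + crossedLevels e ≤ crossed e
    private-split⇒1+crossedLevels≤crossed {i} {x} {y} x∈e px y∈e ¬py with depthView y | deepest (x , x∈e)
    ... | one j py | _ = ≤-trans (n≤1+n _)
          (private-pair⇒2+crossedLevels≤crossed (λ i≡j → ¬py (subst (λ k → Private k y) (sym i≡j) py)) x∈e px y∈e py)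
    ... | none y≤0 | z , z∈e , max = begin
      1 + crossedLevels e   ≤⟨ +-monoʳ-≤ 1 (crossedLevels≤depth∸2 {z} max) ⟩
      1 + (depth z ∸ 2)     ≤⟨ +-monoʳ-≤ 1 (∸-monoʳ-≤ (depth z) (s≤s z≤n)) ⟩
      1 + (depth z ∸ 1)     ≡⟨ m+[n∸m]≡n 1≤depth ⟩
      depth z               ≤⟨ depth≤depth+crossed z∈e y∈e ⟩
      depth y + crossed e   ≤⟨ +-monoˡ-≤ (crossed e) y≤0 ⟩
      crossed e             ∎
      where
      open ≤-Reasoning
      1≤depth : 1 ≤ depth z
      1≤depth = ≤-trans
        (≤-trans (1≤⟦⟧ (x ∈? A i) (proj₁ px))
          (≤-trans (m≤m+n _ _) (≤-reflexive (sym (sum-remove {i = i} (λ q → ⟦ x ∈? A q ⟧))))))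
        (max x∈e)
    -- Here `depth z` is at least 2, so `depth z ∸ 2` is not truncated; one of the two units gained
    -- is lost again to the depth of `x`.
    ... | many 2≤y | z , z∈e , max = +-cancelˡ-≤ 1 _ _ (begin
      2 + crossedLevels e   ≤⟨ +-monoʳ-≤ 2 (crossedLevels≤depth∸2 {z} max) ⟩
      2 + (depth z ∸ 2)     ≡⟨ m+[n∸m]≡n (≤-trans 2≤y (max y∈e)) ⟩
      depth z               ≤⟨ depth≤depth+crossed z∈e x∈e ⟩
      depth x + crossed e   ≤⟨ +-monoˡ-≤ (crossed e) (private⇒depth≤1 px) ⟩
      1 + crossed e         ∎)
      where open ≤-Reasoning

  -- The partition given by a family of indices

  module Selection {h : ℕ} (g : Fin h → Fin (2 + s)) (g-inj : Injective _≡_ _≡_ g) where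

    -- Encoding the partition as a function on vertices makes disjointness and covering immediate.
    -- The last index `fromℕ h` collects every vertex that is private to no selected index.
    part : Fin n → Fin (suc h)
    part v with any? (λ t → private? (g t) v)
    ... | yes (t , _) = inject₁ t
    ... | no _        = fromℕ h

    -- A vertex is private to at most one index and `g` is injective, so the search can only find
    -- `t`.
    part-selected : ∀ {t v} → Private (g t) v → part v ≡ inject₁ t
    part-selected {t} {v} pv with any? (λ t → private? (g t) v)
    ... | yes (t′ , pv′) = cong inject₁ (g-inj (private-unique pv′ pv))
    ... | no ∄t          = ⊥-elim (∄t (t , pv))

    part-last : ∀ {v} → (∀ i → ¬ Private i v) → part v ≡ fromℕ h
    part-last {v} ¬pv with any? (λ t → private? (g t) v)
    ... | yes (t , pv) = ⊥-elim (¬pv (g t) pv)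
    ... | no _         = refl

    part-inv : ∀ v → (∃ λ t → Private (g t) v) ⊎ part v ≡ fromℕ h
    part-inv v with any? (λ t → private? (g t) v)
    ... | yes selected = inj₁ selected
    ... | no _         = inj₂ refl

    parts : Fin (suc h) → Subset n
    parts i = subset λ v → part v ≟ i

    ∈-parts⁺ : ∀ {i v} → part v ≡ i → v ∈ parts i
    ∈-parts⁺ {i} = ∈-subset⁺ (λ v → part v ≟ i)

    ∈-parts⁻ : ∀ {i v} → v ∈ parts i → part v ≡ i
    ∈-parts⁻ {i} = ∈-subset⁻ (λ v → part v ≟ i)

    -- The vertex `r`, private to no index, keeps the last part non-empty.
    parts-isPartition : (∀ i → ∃ (Private i)) → (∃ λ r → ∀ i → ¬ Private i r) → IsPartition parts
    parts-isPartition pr (r , ¬pr) = record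
      { nonempty = nonempty
      ; disjoint = λ i j i≢j (x , x∈) → let (x∈i , x∈j) = x∈p∩q⁻ (parts i) (parts j) x∈ in
          i≢j (trans (sym (∈-parts⁻ x∈i)) (∈-parts⁻ x∈j))
      ; cover    = λ x → part x , ∈-parts⁺ refl
      }
      where
      nonempty : ∀ i → Nonempty (parts i)
      nonempty i with view i
      ... | ‵fromℕ      = r , ∈-parts⁺ (part-last ¬pr)
      ... | ‵inject₁ t  = let (v , pv) = pr (g t) in v , ∈-parts⁺ (part-selected pv)

    -- Two vertices in different parts are not both in the last one, so one of them is private to a
    -- selected index to which the other is not.
    meetsTwoParts⁻ : ∀ {e} → MeetsTwoParts parts e →
      ∃ λ t → ∃ λ x → ∃ λ y → x ∈ e × Private (g t) x × y ∈ e × ¬ Private (g t) y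
    meetsTwoParts⁻ {e} (i , j , i≢j , (x , x∈) , (y , y∈)) = split (part-inv x) (part-inv y)
      where
      x∈e = proj₁ (x∈p∩q⁻ e (parts i) x∈)
      y∈e = proj₁ (x∈p∩q⁻ e (parts j) y∈)

      apart : part x ≢ part y
      apart eq = i≢j (trans (sym (∈-parts⁻ (proj₂ (x∈p∩q⁻ e (parts i) x∈))))
        (trans eq (∈-parts⁻ (proj₂ (x∈p∩q⁻ e (parts j) y∈)))))

      split : (∃ λ t → Private (g t) x) ⊎ part x ≡ fromℕ h →
        (∃ λ t → Private (g t) y) ⊎ part y ≡ fromℕ h → _
      split (inj₁ (t , px)) _ =
        t , x , y , x∈e , px , y∈e , λ py → apart (trans (part-selected px) (sym (part-selected py)))
      split (inj₂ _) (inj₁ (t , py)) =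
        t , y , x , y∈e , py , x∈e , λ px → apart (trans (part-selected px) (sym (part-selected py)))
      split (inj₂ x-last) (inj₂ y-last) = ⊥-elim (apart (trans x-last (sym y-last)))

  -- Comparing the costs for two disjoint families

  module _ {h : ℕ} (g g′ : Fin h → Fin (2 + s)) (g-inj : Injective _≡_ _≡_ g)
           (g′-inj : Injective _≡_ _≡_ g′) (g≢g′ : ∀ t t′ → g t ≢ g′ t′) where

    private
      module S  = Selection g g-inj
      module S′ = Selection g′ g′-inj

    -- If both partitions cut `e`, then `e` has a private vertex for an index of each family;
    -- disjointness makes these indices different, so the bound for pairs applies. If only one cuts
    -- `e`, the split bound suffices.
    edge-bound : ∀ e → ⟦ meetsTwoParts? S.parts e ⟧ + ⟦ meetsTwoParts? S′.parts e ⟧ + crossedLevels e ≤ crossed e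
    edge-bound e = bound (meetsTwoParts? S.parts e) (meetsTwoParts? S′.parts e)
      where
      -- The decisions are passed as arguments so that matching on them evaluates both indicators.
      bound : (m? : Dec (MeetsTwoParts S.parts e)) (m′? : Dec (MeetsTwoParts S′.parts e)) →
        ⟦ m? ⟧ + ⟦ m′? ⟧ + crossedLevels e ≤ crossed e
      bound (no _) (no _) = crossedLevels≤crossed e
      bound (yes m) (no _) =
        let (_ , _ , _ , x∈e , px , y∈e , ¬py) = S.meetsTwoParts⁻ m
        in private-split⇒1+crossedLevels≤crossed e x∈e px y∈e ¬py
      bound (no _) (yes m′) =
        let (_ , _ , _ , x∈e , px , y∈e , ¬py) = S′.meetsTwoParts⁻ m′
        in private-split⇒1+crossedLevels≤crossed e x∈e px y∈e ¬py
      bound (yes m) (yes m′) =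
        let (t , _ , _ , x∈e , px , _) = S.meetsTwoParts⁻ m
            (t′ , _ , _ , y∈e , py , _) = S′.meetsTwoParts⁻ m′
        in private-pair⇒2+crossedLevels≤crossed e (g≢g′ t t′) x∈e px y∈e py

    cost-bound : ∀ G → cost G S.parts + cost G S′.parts + sum {s} (λ t → d G (level (3 + toℕ t)))
      ≤ sum (λ q → d G (A q))
    cost-bound G = length-filter-sum-mono {a = s} {b = 2 + s} (meetsTwoParts? S.parts) (meetsTwoParts? S′.parts)
      (λ t → crosses? (level (3 + toℕ t))) (λ q → crosses? (A q)) edge-bound (edges G)

-- A minimising pair of indices

minPair : ∀ {s} (f : Fin (2 + s) → ℕ) → ∃ λ i → ∃ λ j → i ≢ j × IsMinimum (PairSum f) (f i + f j)
minPair {s} f = i , j , i≢j , (i , j , i≢j , refl) , λ where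
    _ (i′ , j′ , i′≢j′ , refl) → min (∈-cartesianProduct⁺ (∈-allFin i′) (∈-allFin j′)) i′≢j′
  where
  -- The search starts from the first two indices, which exist because p is at least 2.
  best = minimiser {P = λ (i , j) → i ≢ j} (λ (i , j) → ¬? (i ≟ j)) (λ (i , j) → f i + f j)
    (cartesianProduct (allFin (2 + s)) (allFin (2 + s))) ((zero , suc zero) , λ ())
  i   = proj₁ (proj₁ best)
  j   = proj₂ (proj₁ best)
  i≢j = proj₁ (proj₂ best)
  min = proj₂ (proj₂ best)

-- Levels as competing terminal cuts

module _ {n s : ℕ} (G : Hypergraph n) {R U : Subset n} (R≠∅ : Nonempty R) (R⊂U : R ⊂ U) (U⊂⊤ : U ⊂ ⊤)
  (u : Fin (2 + s) → Fin n) (S⊆U─R : image u ⊆ U ─ R) (A : Fin (2 + s) → Subset n)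
  (A-min : ∀ i → IsMinTerminalCut G ((image u ∪ R) - u i) (∁ U) (∁ (A i)))
  (u∈A : ∀ i → u i ∈ A i ─ ⋃Except i A) where

  open IsMinTerminalCut
  open IsTerminalCut

  u-private : ∀ i → Private A i (u i)
  u-private i = p─q⊆p (A i) _ (u∈A i) , only-i
    where
    only-i : ∀ j → u i ∈ A j → j ≡ i
    only-i j ui∈Aj with j ≟ i
    ... | yes j≡i = j≡i
    ... | no j≢i  = ⊥-elim (x∈p─q⇒x∉q (A i) _ (u∈A i)
      (∈-⋃-map⁺ A (∈-filter⁺ (λ j → ¬? (j ≟ i)) (∈-allFin j) j≢i) ui∈Aj))

  -- The terminals lie outside `R`, so removing `u q` leaves `r` in the source set of each cut.
  R∩A : ∀ {r} → r ∈ R → ∀ q → r ∉ A q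
  R∩A {r} r∈R q = x∈∁p⇒x∉p (source (isTerminalCut (A-min q))
    (x∈p∧x≢y⇒x∈p-y (x∈p∪q⁺ (inj₂ r∈R)) λ r≡u →
      x∈p─q⇒x∉q U R (S⊆U─R (∈-image⁺ u q)) (subst (_∈ R) r≡u r∈R)))

  ∁U⊆A : ∀ {v} → v ∈ ∁ U → ∀ q → v ∈ A q
  ∁U⊆A v∈∁U q = ∉∁⇒∈ λ v∈∁A → x∈∁p⇒x∉p (sink (isTerminalCut (A-min q)) v∈∁A) v∈∁U

  -- A vertex of `∁ U` lies in every `A q`, hence in two different ones.
  ∁U⇒¬private : ∀ {v} → v ∈ ∁ U → ∀ i → ¬ Private A i v
  ∁U⇒¬private v∈∁U i (_ , only-i)
    with trans (only-i zero (∁U⊆A v∈∁U zero)) (sym (only-i (suc zero) (∁U⊆A v∈∁U (suc zero))))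
  ... | ()

  -- Vertices of `∁ U` have depth p, vertices of `R` depth 0, and terminals depth at most 1. The
  -- level avoids all terminals, `u q` included, so the same level competes with every cut.
  level-isTerminalCut : ∀ {l} → 2 ≤ l → l ≤ 2 + s → ∀ q →
    IsTerminalCut ((image u ∪ R) - u q) (∁ U) (∁ (level A l))
  level-isTerminalCut {l} 2≤l l≤p q = record
    { nonemptyˡ = let (r , r∈R) = R≠∅ in r , R⇒∁level r∈R
    ; nonemptyʳ = let (_ , x , _ , x∉U) = U⊂⊤ in
        x , x∉p⇒x∈∁p (λ x∈∁L → x∈∁p⇒x∉p x∈∁L (∁U⇒level (x∉p⇒x∈∁p x∉U)))
    ; source    = terminals
    ; sink      = λ v∈∁L → x∉p⇒x∈∁p λ v∈∁U → x∈∁p⇒x∉p v∈∁L (∁U⇒level v∈∁U)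
    }
    where
    shallow⇒∁level : ∀ {v} → depth A v ≤ 1 → v ∈ ∁ (level A l)
    shallow⇒∁level v≤1 = x∉p⇒x∈∁p λ v∈L →
      <⇒≱ (≤-trans (s≤s v≤1) 2≤l) (∈-subset⁻ (λ v → l ≤? depth A v) v∈L)

    R⇒∁level : ∀ {r} → r ∈ R → r ∈ ∁ (level A l)
    R⇒∁level r∈R = shallow⇒∁level (≤-trans (∉all⇒depth≤0 A (R∩A r∈R)) z≤n)

    ∁U⇒level : ∀ {v} → v ∈ ∁ U → v ∈ level A l
    ∁U⇒level v∈∁U = ∈-subset⁺ (λ v → l ≤? depth A v) (≤-trans l≤p (∈all⇒depth A (∁U⊆A v∈∁U)))

    terminals : (image u ∪ R) - u q ⊆ ∁ (level A l)
    terminals v∈ with x∈p∪q⁻ (image u) R (p─q⊆p (image u ∪ R) ⁅ u q ⁆ v∈)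
    ... | inj₂ v∈R = R⇒∁level v∈R
    ... | inj₁ v∈S with ∈-image⁻ u v∈S
    ...   | i , refl = shallow⇒∁level (private⇒depth≤1 A (u-private i))

  d≤d-level : ∀ {l} → 2 ≤ l → l ≤ 2 + s → ∀ q → d G (A q) ≤ d G (level A l)
  d≤d-level {l} 2≤l l≤p q = begin
    d G (A q)             ≡⟨ d-∁ G (A q) ⟨
    d G (∁ (A q))         ≤⟨ minimum (A-min q) (∁ (level A l)) (level-isTerminalCut 2≤l l≤p q) ⟩
    d G (∁ (level A l))   ≡⟨ d-∁ G (level A l) ⟩
    d G (level A l)       ∎
    where open ≤-Reasoning

  -- Each of the p - 2 terms outside the pair is at most the largest value `D`, and each of the p -
  -- 2 levels has cut value at least `D`.
  d-sum≤pair+levels : ∀ {i j} → i ≢ j →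
    sum (λ q → d G (A q)) ≤ d G (A i) + d G (A j) + sum {s} (λ t → d G (level A (3 + toℕ t)))
  d-sum≤pair+levels {i} {j} i≢j = begin
    sum (λ q → d G (A q))                               ≤⟨ sum≤pair+ (λ q → d G (A q)) D i≢j d≤D ⟩
    d G (A i) + d G (A j) + s * D                       ≡⟨ cong (d G (A i) + d G (A j) +_) (sum-const s D) ⟨
    d G (A i) + d G (A j) + sum {s} (λ _ → D)           ≤⟨ +-monoʳ-≤ (d G (A i) + d G (A j)) D-sum≤ ⟩
    d G (A i) + d G (A j) + sum {s} (λ t → d G (level A (3 + toℕ t))) ∎
    where
    open ≤-Reasoning
    -- The always true predicate `q ≡ q` lets the maximum range over all indices.
    largest = maximiser {P = λ q → q ≡ q} (λ q → q ≟ q) (λ q → d G (A q)) (allFin (2 + s)) (zero , refl)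
    D = d G (A (proj₁ largest))

    d≤D : ∀ q → d G (A q) ≤ D
    d≤D q = proj₂ (proj₂ largest) (∈-allFin q) refl

    D-sum≤ : sum {s} (λ _ → D) ≤ sum {s} (λ t → d G (level A (3 + toℕ t)))
    D-sum≤ = sum-mono-≤ {s} (λ _ → D) (λ t → d G (level A (3 + toℕ t))) λ t →
      d≤d-level (s≤s (s≤s z≤n)) (s≤s (s≤s (toℕ<n t))) (proj₁ largest)

  -- Choosing the cheaper of two partitions

  module _ {h : ℕ} (h+h≤p : h + h ≤ 2 + s) where

    private
      -- The families are the first `h` indices and the next `h`, as the two halves of
      -- `Fin (h + h)`.
      g g′ : Fin h → Fin (2 + s)
      g  t = inject≤ (t ↑ˡ h) h+h≤p
      g′ t = inject≤ (h ↑ʳ t) h+h≤p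

      g-inj : Injective _≡_ _≡_ g
      g-inj eq = ↑ˡ-injective h _ _ (inject≤-injective h+h≤p h+h≤p _ _ eq)

      g′-inj : Injective _≡_ _≡_ g′
      g′-inj eq = ↑ʳ-injective h _ _ (inject≤-injective h+h≤p h+h≤p _ _ eq)

      g≢g′ : ∀ t t′ → g t ≢ g′ t′
      g≢g′ t t′ eq with trans (sym (splitAt-↑ˡ h t h))
        (trans (cong (splitAt h) (inject≤-injective h+h≤p h+h≤p _ _ eq)) (splitAt-↑ʳ h h t′))
      ... | ()

    Conclusion : Set
    Conclusion = Σ (Fin (suc h) → Subset n) λ P →
      IsPartition P
      × ∁ U ⊂ P (fromℕ h)
      × Σ ℕ λ m → IsMinimum (PairSum (λ i → d G (A i))) m × 2 * cost G P ≤ m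

    cheap-partition : Conclusion
    cheap-partition = choose (≤-total (cost G S.parts) (cost G S′.parts))
      where
      module S  = Selection A g g-inj
      module S′ = Selection A g′ g′-inj

      smallest = minPair (λ i → d G (A i))
      i   = proj₁ smallest
      j   = proj₁ (proj₂ smallest)
      i≢j = proj₁ (proj₂ (proj₂ smallest))
      m   = d G (A i) + d G (A j)

      isMin : IsMinimum (PairSum (λ i → d G (A i))) m
      isMin = proj₂ (proj₂ (proj₂ smallest))

      costs≤m : cost G S.parts + cost G S′.parts ≤ m
      -- The level sum appears on both sides and cancels.
      costs≤m = +-cancelʳ-≤ (sum {s} (λ t → d G (level A (3 + toℕ t)))) _ _
        (≤-trans (cost-bound A g g′ g-inj g′-inj g≢g′ G) (d-sum≤pair+levels i≢j))

      r = proj₁ R≠∅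
      r∈R = proj₂ R≠∅

      r-not-private : ∀ i → ¬ Private A i r
      r-not-private i (r∈A , _) = R∩A r∈R i r∈A

      finish : (f : Fin h → Fin (2 + s)) (f-inj : Injective _≡_ _≡_ f) →
        let open Selection A f f-inj in 2 * cost G parts ≤ m → Conclusion
      finish f f-inj le = parts
        , parts-isPartition (λ i → u i , u-private i) (r , r-not-private)
        , ((λ v∈∁U → ∈-parts⁺ (part-last (∁U⇒¬private v∈∁U)))
          -- The inclusion is strict because `r` is in the last part but also in `U`.
          , r , ∈-parts⁺ (part-last r-not-private) , λ r∈∁U → x∈∁p⇒x∉p r∈∁U (proj₁ R⊂U r∈R))
        , m , isMin , le
        where open Selection A f f-inj

      2*≤ : ∀ {a b} → a ≤ b → a + b ≤ m → 2 * a ≤ m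
      2*≤ {a} a≤b = ≤-trans (+-monoʳ-≤ a (≤-trans (≤-reflexive (+-identityʳ a)) a≤b))

      choose : cost G S.parts ≤ cost G S′.parts ⊎ cost G S′.parts ≤ cost G S.parts → Conclusion
      choose (inj₁ c≤c′) = finish g g-inj (2*≤ c≤c′ costs≤m)
      choose (inj₂ c′≤c) = finish g′ g′-inj
        (2*≤ c′≤c (≤-trans (≤-reflexive (+-comm (cost G S′.parts) (cost G S.parts))) costs≤m))

-- From the number of parts to the size of the families

2[2+j]∸2≡ : ∀ j → 2 * (2 + j) ∸ 2 ≡ suc j + suc j
2[2+j]∸2≡ j = trans (cong (j +_) (+-identityʳ (2 + j))) (+-suc j (suc j))

theorem3p1 : ∀ {n : ℕ} (G : Hypergraph n)
    (k : ℕ) (k≥2 : 2 ≤ k)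
    (R U : Subset n) → Nonempty R → R ⊂ U → U ⊂ ⊤ →
    (p : ℕ) → 2 * k ∸ 2 ≤ p →
    (u : Fin p → Fin n) → Injective _≡_ _≡_ u → image u ⊆ U ─ R →
    (A : Fin p → Subset n) →
    (∀ i → IsMinTerminalCut G ((image u ∪ R) - u i) (∁ U) (∁ (A i))) →
    (∀ i → u i ∈ A i ─ ⋃Except i A) →
    Σ (Fin k → Subset n) λ P →
    IsPartition P
    × ∁ U ⊂ P (lastIndex k≥2)
    × Σ ℕ λ m → IsMinimum (PairSum (λ i → d G (A i))) m × 2 * cost G P ≤ m
-- For k = 2 + j the families have size `suc j`, that is k - 1, so together they use 2k - 2 indices.
-- Matching on the proof of 2 ≤ k lets `lastIndex` reduce to `fromℕ (suc j)`.
theorem3p1 G (suc (suc j)) (s≤s (s≤s z≤n)) R U R≠∅ R⊂U U⊂⊤ (suc (suc s)) 2k∸2≤p u _ S⊆U─R A A-min u∈A =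
  cheap-partition G R≠∅ R⊂U U⊂⊤ u S⊆U─R A A-min u∈A (subst (_≤ 2 + s) (2[2+j]∸2≡ j) 2k∸2≤p)
-- As 2k - 2 is at least 2, the values 1 and 0 of p contradict the hypothesis.
theorem3p1 G (suc (suc j)) (s≤s (s≤s z≤n)) R U _ _ _ (suc zero) 2k∸2≤p
  with subst (_≤ 1) (trans (2[2+j]∸2≡ j) (cong suc (+-suc j j))) 2k∸2≤p
... | s≤s ()
theorem3p1 G (suc (suc j)) (s≤s (s≤s z≤n)) R U _ _ _ zero 2k∸2≤p
  with subst (_≤ 0) (2[2+j]∸2≡ j) 2k∸2≤p
... | ()
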